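{- Let $G=(V,E,w)$ be a weighted undirected connected graph with $n$ vertices and $m$ edges, and let $\Pi_G=U\Sigma V^T$ be a thin SVD of its edge-vertex incidence matrix with $U\in\mathbb{R}^{n\times(n-1)}$, $\Sigma\in\mathbb{R}^{(n-1)\times(n-1)}$, $V\in\mathbb{R}^{m\times(n-1)}$, and let $Y=V^T$. Then: (1) if $T$ is a spanning tree of $G$, then $\mathrm{St}_T(G)=\|Y_{\mathcal S(T)}^{ -1}\|_F^2$; (2) if $\mathcal S\subseteq[m]$ has cardinality $n-1$ and $Y_{\mathcal S}$ has full rank, then $H(\mathcal S)$ is a spanning tree of $G$.
   Context: Let $V=\{1,\dots,n\}$, $E=\{(u_1,v_1),\dots,(u_m,v_m)\}$, with positive weights $w$. The edge-vertex incidence matrix $\Pi_G\in\mathbb{R}^{n\times m}$ has $i$-th column $\sqrt{w(u_i,v_i)}(e_{u_i}-e_{v_i})$, where $e_j$ are standard basis vectors; since $G$ is connected, $\mathrm{rank}(\Pi_G)=n-1$. For a set of edges (e.g. of a spanning tree $T$), $\mathcal S(T)\subseteq[m]$ is the set of indices of its edges; for $\mathcal S\subseteq[m]$, $H(\mathcal S)$ is the subgraph of $G$ on vertex set $V$ with the edges indexed by $\mathcal S$. $Y_{\mathcal S}$ is the submatrix of columns of $Y$ indexed by $\mathcal S$. For a spanning tree $T$ and edge $e\in E$, let $p_T(e)$ be the set of edges on the unique path in $T$ between the endpoints of $e$; the stretch of $e$ is $\mathrm{St}_T(e)=\sum_{e'\in p_T(e)}w(e)/w(e')$, and $\mathrm{St}_T(G)=\sum_{e\in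 E}\mathrm{St}_T(e)$. $\|\cdot\|_F$ is the Frobenius norm. -}

module Defs where

open import Algebra.Apartness.Bundles using (HeytingField)
open import Algebra.Bundles using (CommutativeRing)
open import Algebra.Definitions using (Invertible)
import Algebra.Definitions.RawMonoid as RawMonoidOps
import Algebra.Properties.AbelianGroup as AbelianGroupProperties
import Algebra.Properties.Semiring.Sum as SemiringSum
open import Data.Bool.Base using (if_then_else_)
open import Data.Fin.Base using (Fin; zero; suc)
open import Data.Fin.Properties using (_≟_)
open import Data.Fin.Subset using (Subset; inside; outside; _∈_; ∣_∣)
open import Data.List.Base as List using (List; []; _∷_)
open import Data.List.Relation.Unary.Unique.Propositional using (Unique)
open import Data.Nat.Base as ℕ using (ℕ; suc; _⊓_)
open import Data.Product.Base using (Σ; ∃-syntax; _×_; _,_; proj₁; proj₂)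
open import Data.Sum.Base using (_⊎_; inj₁; inj₂)
open import Data.Vec.Base as Vec using ([]; _∷_)
open import Data.Vec.Functional using (Vector)
open import Function.Bundles using (_⇔_; Equivalence)
open import Function.Definitions using (Injective)
open import Level using (_⊔_) renaming (suc to lsuc)
open import Relation.Binary.Core using (Rel)
open import Relation.Binary.PropositionalEquality.Core using (_≡_; _≢_)
open import Relation.Binary.Structures using (IsStrictPartialOrder)
open import Relation.Nullary using (¬_; does)

-- An axiomatic presentation of ℝ: a Cauchy complete Archimedean ordered
-- field.  Classically these axioms determine ℝ up to isomorphism.  They
-- use apartness and a non-decidable order, so that the constructive reals
-- satisfy them too.  Square roots exist by completeness; √ only names
-- them (its values at negative arguments are irrelevant).
record RealNumbers c ℓ₁ ℓ₂ : Set (lsuc (c ⊔ ℓ₁ ⊔ ℓ₂)) where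
  infix 4 _<_ _≤_

  field
    heytingField : HeytingField c ℓ₁ ℓ₂

  open HeytingField heytingField public

  commutativeRing : CommutativeRing c ℓ₁
  commutativeRing = record { isCommutativeRing = isCommutativeRing }

  open CommutativeRing commutativeRing public
    using (semiring; +-abelianGroup; +-rawMonoid)
  open RawMonoidOps +-rawMonoid public
    using () renaming (_×_ to _·_)

  field
    _<_                    : Rel Carrier ℓ₂
    <-isStrictPartialOrder : IsStrictPartialOrder _≈_ _<_
    #⇔<⊎>                  : ∀ {x y} → x # y ⇔ (x < y ⊎ y < x)
    +-monoˡ-<              : ∀ {x y} z → x < y → x + z < y + z
    *-pos                  : ∀ {x y} → 0# < x → 0# < y → 0# < x * y

  _≤_ : Rel Carrier ℓ₂
  x ≤ y = ¬ (y < x)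

  WithinOf : Carrier → Rel Carrier ℓ₂
  WithinOf ε x y = (- ε < x - y) × (x - y < ε)

  IsCauchy : (ℕ → Carrier) → Set _
  IsCauchy s = ∀ ε → 0# < ε →
    ∃[ N ] (∀ i j → N ℕ.≤ i → N ℕ.≤ j → WithinOf ε (s i) (s j))

  ConvergesTo : (ℕ → Carrier) → Carrier → Set _
  ConvergesTo s x = ∀ ε → 0# < ε →
    ∃[ N ] (∀ i → N ℕ.≤ i → WithinOf ε (s i) x)

  field
    archimedean : ∀ x → ∃[ n ] x < n · 1#
    complete    : ∀ s → IsCauchy s → ∃[ x ] ConvergesTo s x

    √_          : Carrier → Carrier
    √-cong      : ∀ {x y} → x ≈ y → √ x ≈ √ y
    √-nonneg    : ∀ {x} → 0# ≤ x → 0# ≤ √ x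
    √-square    : ∀ {x} → 0# ≤ x → √ x * √ x ≈ x

  positive⇒invertible : ∀ {x} → 0# < x → Invertible _≈_ 1# _*_ x
  positive⇒invertible {x} 0<x = y , trans (*-congˡ x≈x-0) left
                                  , trans (*-congʳ x≈x-0) right
    where
    inv : Invertible _≈_ 1# _*_ (x - 0#)
    inv = #⇒invertible (Equivalence.from #⇔<⊎> (inj₂ 0<x))

    y : Carrier
    y = proj₁ inv

    left : y * (x - 0#) ≈ 1#
    left = proj₁ (proj₂ inv)

    right : (x - 0#) * y ≈ 1#
    right = proj₂ (proj₂ inv)

    x≈x-0 : x ≈ x - 0#
    x≈x-0 = sym (trans (+-congˡ (AbelianGroupProperties.ε⁻¹≈ε +-abelianGroup))
                       (+-identityʳ x))

  reciprocal : ∀ {x} → 0# < x → Carrier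
  reciprocal 0<x = proj₁ (positive⇒invertible 0<x)


-- The increasing enumeration of a subset of Fin m.
elements : ∀ {m} (S : Subset m) → Fin ∣ S ∣ → Fin m
elements (inside  ∷ S) zero    = zero
elements (inside  ∷ S) (suc i) = suc (elements S i)
elements (outside ∷ S) i       = suc (elements S i)


-- A simple graph with vertex set Fin n and edges e = {src e , tgt e}
-- indexed by Fin m.  The order of the two endpoints only fixes the signs
-- in the incidence matrix.
record Graph (n m : ℕ) : Set where
  field
    src tgt : Fin m → Fin n

  Joins : Fin m → Fin n → Fin n → Set
  Joins e u v = (src e ≡ u × tgt e ≡ v) ⊎ (src e ≡ v × tgt e ≡ u)

  field
    loopless : ∀ e → src e ≢ tgt e
    simple   : ∀ d e → Joins d (src e) (tgt e) → d ≡ e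

-- The notions below, indexed by S, are about the spanning subgraph H(S):
-- all the vertices of G, and the edges in S.
module _ {n m : ℕ} (G : Graph n m) (S : Subset m) where
  open Graph G

  data Walk : Fin n → Fin n → Set where
    nil  : ∀ {u} → Walk u u
    step : ∀ {u v x} (e : Fin m) → e ∈ S → Joins e u v → Walk v x → Walk u x

module _ {n m : ℕ} {G : Graph n m} {S : Subset m} where

  edges : ∀ {u v} → Walk G S u v → List (Fin m)
  edges nil            = []
  edges (step e _ _ p) = e ∷ edges p

  laterVertices : ∀ {u v} → Walk G S u v → List (Fin n)
  laterVertices nil                    = []
  laterVertices (step {v = v} _ _ _ p) = v ∷ laterVertices p

  vertices : ∀ {u v} → Walk G S u v → List (Fin n)
  vertices {u} p = u ∷ laterVertices p

  IsPath : ∀ {u v} → Walk G S u v → Set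
  IsPath p = Unique (vertices p)

  IsCycle : ∀ {u} → Walk G S u u → Set
  IsCycle p = edges p ≢ [] × Unique (edges p) × Unique (laterVertices p)

module _ {n m : ℕ} (G : Graph n m) where
  open Graph G

  IsConnected : Subset m → Set
  IsConnected S = ∀ u v → Σ (Walk G S u v) IsPath

  IsAcyclic : Subset m → Set
  IsAcyclic S = ∀ {u} (p : Walk G S u u) → ¬ IsCycle p

  record IsSpanningTree (T : Subset m) : Set where
    field
      connected : IsConnected T
      acyclic   : IsAcyclic T

    -- The edges of the path in T between the endpoints of e: it is unique
    -- because T is acyclic, and no edge is listed twice because it is a path.
    treePath : Fin m → List (Fin m)
    treePath e = edges (proj₁ (connected (src e) (tgt e)))


module OverReals {c ℓ₁ ℓ₂} (ℝ : RealNumbers c ℓ₁ ℓ₂) where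
  open RealNumbers ℝ
  open SemiringSum semiring using (sum)

  Matrix : ℕ → ℕ → Set c
  Matrix r s = Fin r → Fin s → Carrier

  infix 4 _≈ᴹ_
  infixl 7 _*ᴹ_
  infix 8 _ᵀ

  _≈ᴹ_ : ∀ {r s} → Rel (Matrix r s) ℓ₁
  A ≈ᴹ B = ∀ i j → A i j ≈ B i j

  _*ᴹ_ : ∀ {r s t} → Matrix r s → Matrix s t → Matrix r t
  (A *ᴹ B) i k = sum (λ j → A i j * B j k)

  _ᵀ : ∀ {r s} → Matrix r s → Matrix s r
  (A ᵀ) i j = A j i

  1ᴹ : ∀ {r} → Matrix r r
  1ᴹ i j = if does (i ≟ j) then 1# else 0#

  columns : ∀ {r s} → Matrix r s → (S : Subset s) → Matrix r ∣ S ∣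
  columns A S i j = A i (elements S j)

  IsInverse : ∀ {r s} → Matrix r s → Matrix s r → Set ℓ₁
  IsInverse A B = (A *ᴹ B ≈ᴹ 1ᴹ) × (B *ᴹ A ≈ᴹ 1ᴹ)

  ∥_∥F : ∀ {r s} → Matrix r s → Carrier
  ∥ A ∥F = √ sum (λ i → sum (λ j → A i j * A i j))

  LinearlyIndependent : ∀ {r t} → (Fin t → Vector Carrier r) → Set (c ⊔ ℓ₁)
  LinearlyIndependent {t = t} v = (a : Fin t → Carrier) →
    (∀ i → sum (λ j → a j * v j i) ≈ 0#) → ∀ j → a j ≈ 0#

  IndependentColumns : ∀ {r s} → Matrix r s → ℕ → Set (c ⊔ ℓ₁)
  IndependentColumns {s = s} A t = ∃[ f ]
    (Injective {A = Fin t} {B = Fin s} _≡_ _≡_ f × LinearlyIndependent (λ j → (A ᵀ) (f j)))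

  HasRank : ∀ {r s} → Matrix r s → ℕ → Set (c ⊔ ℓ₁)
  HasRank A t = IndependentColumns A t × (∀ t′ → IndependentColumns A t′ → t′ ℕ.≤ t)

  FullRank : ∀ {r s} → Matrix r s → Set (c ⊔ ℓ₁)
  FullRank {r} {s} A = HasRank A (r ⊓ s)

  -- A ≈ U D Vᵀ, with an inner dimension k equal to the rank of A, so that
  -- all k singular values are positive.  They need not be sorted.
  record IsThinSVD {r s k} (A : Matrix r s)
                   (U : Matrix r k) (D : Matrix k k) (V : Matrix s k)
                   : Set (c ⊔ ℓ₁ ⊔ ℓ₂) where
    field
      factorization : A ≈ᴹ U *ᴹ D *ᴹ V ᵀ
      U-orthonormal : U ᵀ *ᴹ U ≈ᴹ 1ᴹ
      V-orthonormal : V ᵀ *ᴹ V ≈ᴹ 1ᴹ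
      D-diagonal    : ∀ i j → i ≢ j → D i j ≈ 0#
      D-positive    : ∀ i → 0# < D i i

  record WeightedGraph (n m : ℕ) : Set (c ⊔ ℓ₂) where
    field
      graph           : Graph n m
      weight          : Fin m → Carrier
      weight-positive : ∀ e → 0# < weight e

    open Graph graph public

    incidence : Matrix n m
    incidence i e = √ (weight e) * (1ᴹ i (src e) - 1ᴹ i (tgt e))

    edgeStretch : ∀ {T} → IsSpanningTree graph T → Fin m → Carrier
    edgeStretch tree e = List.foldr _+_ 0#
      (List.map (λ e′ → weight e * reciprocal (weight-positive e′))
                (IsSpanningTree.treePath tree e))

    stretch : ∀ {T} → IsSpanningTree graph T → Carrier
    stretch tree = sum (edgeStretch tree)

{-# OPTIONS --safe #-}

-- Removing an edge t from the spanning tree T leaves two sides; let cut t be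
-- the indicator function of the side of src t.  Along a walk in T, cut t
-- changes by the signed number of traversals of t.  Let the rows of Q be the
-- functions cut t / √w t.  Then Q Π has an entry ± √(w e / w t) wherever t lies
-- on the tree path of e, and zeros elsewhere, so that Q Π is the identity on the
-- columns of T, Π_T Q Π = Π, and the squares of its entries add up to the
-- stretch.  Now Z = Q U Σ satisfies Q Π = Z Y, which makes Z the inverse of
-- Y_T, and ∥ Z Y ∥ = ∥ Z ∥ because the rows of Y are orthonormal.
--
-- Conversely, the signed traversals of a cycle in H(S) give a linear relation
-- between the columns of Y_S.  So independence makes H(S) a forest, and a
-- forest with n - 1 edges is connected.
module Submission where

open import Defs
open import Algebra.Bundles using (CommutativeRing)
import Algebra.Properties.AbelianGroup as AbelianGroupProperties
import Algebra.Properties.CommutativeSemigroup as CommutativeSemigroupProperties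
import Algebra.Properties.Ring as RingProperties
import Algebra.Properties.Semiring.Sum as SemiringSum
open import Data.Bool.Base using (if_then_else_)
open import Data.Fin.Base using (Fin; zero; suc; punchOut)
open import Data.Fin.Permutation using (Permutation; permutation; inverseʳ; _⟨$⟩ˡ_)
open import Data.Fin.Properties using (_≟_; any?; punchOut-injective; injective⇒≤; suc-injective; ¬Fin0)
open import Data.Fin.Subset using (Subset; inside; outside; ∣_∣; ⊤; _∈_; _⊆_) renaming (_-_ to _∖_)
open import Data.Fin.Subset.Properties using (x∈p∧x≢y⇒x∈p-y; p─q⊆p; p─⊥≡p)
open import Data.List.Base as List using (List; []; _∷_)
open import Data.List.Membership.DecPropositional using (_∈?_)
open import Data.List.Membership.Propositional using () renaming (_∈_ to _∈ᴸ_; _∉_ to _∉ᴸ_)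
open import Data.List.Relation.Unary.All as All using (All; []; _∷_)
open import Data.List.Relation.Unary.All.Properties using (¬Any⇒All¬; All¬⇒¬Any)
open import Data.List.Relation.Unary.AllPairs using ([]; _∷_)
open import Data.List.Relation.Unary.Any using (here; there)
open import Data.List.Relation.Unary.Unique.Propositional using (Unique)
open import Data.Nat.Base as ℕ using (ℕ; suc)
import Data.Nat.Properties as ℕ
open import Data.Product.Base using (Σ; ∃-syntax; _×_; _,_; proj₁; proj₂)
open import Data.Sum.Base as Sum using (_⊎_; inj₁; inj₂)
open import Data.Vec.Base using (_∷_; here; there)
open import Function.Base using (_∘_; id)
open import Function.Bundles using (Equivalence)
open import Function.Definitions using (Injective)
open import Relation.Binary.Bundles using (Setoid)
open import Relation.Binary.PropositionalEquality as ≡ using (_≡_; _≢_)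
import Relation.Binary.Reasoning.Setoid as SetoidReasoning
open import Relation.Binary.Structures using (IsStrictPartialOrder)
open import Relation.Nullary using (¬_; yes; no; contradiction)
open import Relation.Nullary.Decidable using (dec-true; dec-false)

-- Enumerations of subsets and injections between finite sets.

elements-∈ : ∀ {m} (S : Subset m) j → elements S j ∈ S
elements-∈ (inside  ∷ S) zero    = here
elements-∈ (inside  ∷ S) (suc j) = there (elements-∈ S j)
elements-∈ (outside ∷ S) j       = there (elements-∈ S j)

∈⇒elements : ∀ {m} {S : Subset m} {e} → e ∈ S → ∃[ j ] elements S j ≡ e
∈⇒elements                     here      = zero , ≡.refl
∈⇒elements {S = inside  ∷ S} (there e∈S) = let j , eq = ∈⇒elements e∈S in suc j , ≡.cong suc eq
∈⇒elements {S = outside ∷ S} (there e∈S) = let j , eq = ∈⇒elements e∈S in j , ≡.cong suc eq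

elements-injective : ∀ {m} (S : Subset m) → Injective _≡_ _≡_ (elements S)
elements-injective (inside  ∷ S) {zero}  {zero}  eq   = ≡.refl
elements-injective (inside  ∷ S) {suc i} {suc j} eq   =
  ≡.cong suc (elements-injective S (suc-injective eq))
elements-injective (outside ∷ S)                 eq   =
  elements-injective S (suc-injective eq)

x∈p⇒∣p∣≡1+∣p-x∣ : ∀ {m} {p : Subset m} {x} → x ∈ p → ∣ p ∣ ≡ suc ∣ p ∖ x ∣
x∈p⇒∣p∣≡1+∣p-x∣ {p = inside  ∷ p} here        = ≡.cong (suc ∘ ∣_∣) (≡.sym (p─⊥≡p p))
x∈p⇒∣p∣≡1+∣p-x∣ {p = inside  ∷ p} (there x∈p) = ≡.cong suc (x∈p⇒∣p∣≡1+∣p-x∣ x∈p)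
x∈p⇒∣p∣≡1+∣p-x∣ {p = outside ∷ p} (there x∈p) = x∈p⇒∣p∣≡1+∣p-x∣ x∈p

x∉p-x : ∀ {m} {p : Subset m} {x} → ¬ (x ∈ p ∖ x)
x∉p-x {p = s ∷ p} {zero}  ()
x∉p-x {p = s ∷ p} {suc x} (there x∈) = x∉p-x x∈

-- Pigeonhole: if `y` were missed, `punchOut` at `y` would turn `f` into an injection into a set
-- with one element fewer.
injective⇒surjective : ∀ {s t} {f : Fin s → Fin t} → s ≡ t → Injective _≡_ _≡_ f → ∀ y → ∃[ x ] f x ≡ y
injective⇒surjective {suc s} {f = f} ≡.refl f-injective y with any? (λ x → f x ≟ y)
... | yes p = p
... | no ¬p = contradiction
  (injective⇒≤ {f = punchOut ∘ y≢f} (f-injective ∘ punchOut-injective (y≢f _) (y≢f _)))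
  ℕ.1+n≰n
  where
  y≢f : ∀ x → y ≢ f x
  y≢f x y≡fx = ¬p (x , ≡.sym y≡fx)

injective⇒permutation : ∀ {s t} (f : Fin s → Fin t) → s ≡ t → Injective _≡_ _≡_ f → Permutation s t
injective⇒permutation f s≡t f-injective = permutation f (proj₁ ∘ preimage) (proj₂ ∘ preimage)
  (λ x → f-injective (proj₂ (preimage (f x))))
  where
  preimage : ∀ y → ∃[ x ] f x ≡ y
  preimage = injective⇒surjective s≡t f-injective

module _ {c : ℕ} {i j : Fin (suc c)} (i≢j : i ≢ j) where

  -- The quotient map gluing `i` to `j`: `i` is punched out of the range and takes over the image of
  -- `j`.
  merge : Fin (suc c) → Fin c
  merge x with i ≟ x
  ... | yes _  = punchOut i≢j
  ... | no i≢x = punchOut i≢x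

  merge-reflects : ∀ x y → merge x ≡ merge y → x ≡ y ⊎ (x ≡ i × y ≡ j) ⊎ (x ≡ j × y ≡ i)
  merge-reflects x y eq with i ≟ x | i ≟ y
  ... | yes ≡.refl | yes ≡.refl = inj₁ ≡.refl
  ... | yes ≡.refl | no i≢y     = inj₂ (inj₁ (≡.refl , ≡.sym (punchOut-injective i≢j i≢y eq)))
  ... | no i≢x     | yes ≡.refl = inj₂ (inj₂ (punchOut-injective i≢x i≢j eq , ≡.refl))
  ... | no i≢x     | no i≢y     = inj₁ (punchOut-injective i≢x i≢y eq)

-- Walks and paths in a subgraph.

module _ {n m : ℕ} {G : Graph n m} where
  open Graph G

  Joins-sym : ∀ {e u v} → Joins e u v → Joins e v u
  Joins-sym = Sum.swap

  module _ {S : Subset m} where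

    infixr 5 _++ʷ_

    _++ʷ_ : ∀ {u v x} → Walk G S u v → Walk G S v x → Walk G S u x
    nil          ++ʷ q = q
    step e i J p ++ʷ q = step e i J (p ++ʷ q)

    reverseʷ : ∀ {u v} → Walk G S u v → Walk G S v u
    reverseʷ nil            = nil
    reverseʷ (step e i J p) = reverseʷ p ++ʷ step e i (Joins-sym J) nil

    edges-⊆ : ∀ {u v} (p : Walk G S u v) → All (_∈ S) (edges p)
    edges-⊆ nil            = []
    edges-⊆ (step e i J p) = i ∷ edges-⊆ p

    suffixPath : ∀ {u v x} (p : Walk G S v x) → IsPath p → u ∈ᴸ vertices p → Σ (Walk G S u x) IsPath
    suffixPath p              pp       (here ≡.refl) = p , pp
    suffixPath (step e i J p) (_ ∷ pp) (there u∈)    = suffixPath p pp u∈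

    -- Loop erasure: when the new start `u` already lies on the path, only the part from that
    -- occurrence onwards is kept.
    toPath : ∀ {u v} → Walk G S u v → Σ (Walk G S u v) IsPath
    toPath nil = nil , [] ∷ []
    toPath (step {u = u} e i J p) with toPath p
    ... | q , qp with _∈?_ _≟_ u (vertices q)
    ...   | yes u∈ = suffixPath q qp u∈
    ...   | no  u∉ = step e i J q , ¬Any⇒All¬ _ u∉ ∷ qp

    Joins-endpoint : ∀ {e u v a b} → Joins e u v → Joins e a b → u ≡ a ⊎ u ≡ b
    Joins-endpoint (inj₁ (≡.refl , ≡.refl)) (inj₁ (≡.refl , ≡.refl)) = inj₁ ≡.refl
    Joins-endpoint (inj₁ (≡.refl , ≡.refl)) (inj₂ (≡.refl , ≡.refl)) = inj₂ ≡.refl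
    Joins-endpoint (inj₂ (≡.refl , ≡.refl)) (inj₁ (≡.refl , ≡.refl)) = inj₂ ≡.refl
    Joins-endpoint (inj₂ (≡.refl , ≡.refl)) (inj₂ (≡.refl , ≡.refl)) = inj₁ ≡.refl

    edge⇒vertex : ∀ {e u v a x} (p : Walk G S a x) → Joins e u v → e ∈ᴸ edges p → u ∈ᴸ vertices p
    edge⇒vertex (step e i J p) Je (there e∈)    = there (edge⇒vertex p Je e∈)
    edge⇒vertex (step e i J p) Je (here ≡.refl) with Joins-endpoint Je J
    ... | inj₁ ≡.refl = here ≡.refl
    ... | inj₂ ≡.refl = there (here ≡.refl)

    -- If the first edge occurred again later, its endpoint `u` would be visited a second time.
    path⇒uniqueEdges : ∀ {u v} (p : Walk G S u v) → IsPath p → Unique (edges p)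
    path⇒uniqueEdges nil            pp        = []
    path⇒uniqueEdges (step e i J p) (u∉ ∷ pp) =
      ¬Any⇒All¬ _ (All¬⇒¬Any u∉ ∘ edge⇒vertex p J) ∷ path⇒uniqueEdges p pp

  mapWalk : ∀ {S S′ : Subset m} → S ⊆ S′ → ∀ {u v} → Walk G S u v → Walk G S′ u v
  mapWalk S⊆ nil            = nil
  mapWalk S⊆ (step e i J p) = step e (S⊆ i) J (mapWalk S⊆ p)

  module _ {S S′ : Subset m} (S⊆ : S ⊆ S′) where

    edges-mapWalk : ∀ {u v} (p : Walk G S u v) → edges (mapWalk S⊆ p) ≡ edges p
    edges-mapWalk nil            = ≡.refl
    edges-mapWalk (step e i J p) = ≡.cong (e ∷_) (edges-mapWalk p)

    laterVertices-mapWalk : ∀ {u v} (p : Walk G S u v) → laterVertices (mapWalk S⊆ p) ≡ laterVertices p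
    laterVertices-mapWalk nil                    = ≡.refl
    laterVertices-mapWalk (step {v = v} e i J p) = ≡.cong (v ∷_) (laterVertices-mapWalk p)

    acyclic-⊆ : IsAcyclic G S′ → IsAcyclic G S
    acyclic-⊆ acyclic p (ne , ue , uv) = acyclic (mapWalk S⊆ p)
      ( (λ eq → ne (≡.trans (≡.sym (edges-mapWalk p)) eq))
      , ≡.subst Unique (≡.sym (edges-mapWalk p)) ue
      , ≡.subst Unique (≡.sym (laterVertices-mapWalk p)) uv)

  -- Removing an edge: bridges and forests.

  module _ {S : Subset m} {t : Fin m} where

    S-t⊆S : S ∖ t ⊆ S
    S-t⊆S = p─q⊆p S _

    -- A walk around `t`, shortened to a path, would close up with `t` to a cycle; `t` is not
    -- repeated because the path avoids it.
    bridge : IsAcyclic G S → t ∈ S → ¬ Walk G (S ∖ t) (src t) (tgt t)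
    -- The cycle starts at `tgt t` and crosses `t` backwards, so that its later vertices are exactly
    -- the vertices of the path `q`.
    bridge acyclic t∈S p = acyclic (step t t∈S (inj₂ (≡.refl , ≡.refl)) r)
      ( (λ ())
      , ¬Any⇒All¬ _ t∉ ∷ ≡.subst Unique (≡.sym (edges-mapWalk S-t⊆S q)) (path⇒uniqueEdges q qp)
      , ≡.subst (λ vs → Unique (src t ∷ vs)) (≡.sym (laterVertices-mapWalk S-t⊆S q)) qp)
      where
      q : Walk G (S ∖ t) (src t) (tgt t)
      q = proj₁ (toPath p)

      qp : IsPath q
      qp = proj₂ (toPath p)

      r : Walk G S (src t) (tgt t)
      r = mapWalk S-t⊆S q

      t∉ : t ∉ᴸ edges r
      t∉ t∈ = x∉p-x {p = S} (All.lookup (edges-⊆ q) (≡.subst (t ∈ᴸ_) (edges-mapWalk S-t⊆S q) t∈))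

    -- The walk is followed up to its first traversal of `t`, or to its end: the endpoint of `t`
    -- found there is reached without `t`.
    side : ∀ {v} → Walk G S v (src t) → Walk G (S ∖ t) v (src t) ⊎ Walk G (S ∖ t) v (tgt t)
    side nil = inj₁ nil
    side (step e i J p) with e ≟ t | J
    ... | yes ≡.refl | inj₁ (≡.refl , ≡.refl) = inj₁ nil
    ... | yes ≡.refl | inj₂ (≡.refl , ≡.refl) = inj₂ nil
    ... | no e≢t     | _                      = Sum.map extend extend (side p)
      where
      extend : ∀ {x} → Walk G (S ∖ t) _ x → Walk G (S ∖ t) _ x
      extend = step e (x∈p∧x≢y⇒x∈p-y i e≢t) J

  -- A forest with c trees has n - c edges: removing an edge t splits a tree,
  -- so a labelling for S arises from one for S ∖ t by merging two labels.
  componentLabels : ∀ (S : Subset m) k → ∣ S ∣ ≡ k → IsAcyclic G S →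
    ∃[ c ] (c ℕ.+ k ≡ n × Σ (Fin n → Fin c) λ label → ∀ u v → label u ≡ label v → Walk G S u v)
  componentLabels S ℕ.zero    _    _       =
    n , ℕ.+-identityʳ n , id , λ { u .u ≡.refl → nil }
  componentLabels S (suc k) ∣S∣≡ acyclic = join
    (componentLabels (S ∖ t) k (ℕ.suc-injective (≡.trans (≡.sym (x∈p⇒∣p∣≡1+∣p-x∣ t∈S)) ∣S∣≡))
      (acyclic-⊆ S-t⊆S acyclic))
    where
    element : ∃[ t ] t ∈ S
    element = elements S (≡.subst Fin (≡.sym ∣S∣≡) zero) , elements-∈ S _

    t : Fin m
    t = proj₁ element

    t∈S : t ∈ S
    t∈S = proj₂ element

    join : ∃[ c ] (c ℕ.+ k ≡ n × Σ (Fin n → Fin c) λ label → ∀ u v → label u ≡ label v → Walk G (S ∖ t) u v) →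
           ∃[ c ] (c ℕ.+ suc k ≡ n × Σ (Fin n → Fin c) λ label → ∀ u v → label u ≡ label v → Walk G S u v)
    -- An empty set of labels cannot label the vertex `src t`.
    join (ℕ.zero , _ , label , _) = contradiction (label (src t)) ¬Fin0
    join (suc c , eq , label , sound) = c , ≡.trans (ℕ.+-suc c k) eq , merge a≢b ∘ label , sound′
      where
      -- Equal labels would yield a walk that bypasses `t`, which `bridge` excludes.
      a≢b : label (src t) ≢ label (tgt t)
      a≢b = bridge acyclic t∈S ∘ sound _ _

      lift : ∀ {u v} → label u ≡ label v → Walk G S u v
      lift = mapWalk S-t⊆S ∘ sound _ _

      sound′ : ∀ u v → merge a≢b (label u) ≡ merge a≢b (label v) → Walk G S u v
      sound′ u v same with merge-reflects a≢b _ _ same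
      ... | inj₁ lu≡lv                = lift lu≡lv
      ... | inj₂ (inj₁ (lu≡a , lv≡b)) = lift lu≡a ++ʷ step t t∈S (inj₁ (≡.refl , ≡.refl)) (lift (≡.sym lv≡b))
      ... | inj₂ (inj₂ (lu≡b , lv≡a)) = lift lu≡b ++ʷ step t t∈S (inj₂ (≡.refl , ≡.refl)) (lift (≡.sym lv≡a))

-- A forest with `k` edges on `suc k` vertices is a single tree, so `componentLabels` leaves one
-- label for all vertices.
acyclic⇒connected : ∀ {k m} {G : Graph (suc k) m} (S : Subset m) → ∣ S ∣ ≡ k →
                    IsAcyclic G S → IsConnected G S
acyclic⇒connected {k} {G = G} S ∣S∣≡k acyclic u v = toPath (connect (componentLabels S k ∣S∣≡k acyclic))
  where
  connect : ∃[ c ] (c ℕ.+ k ≡ suc k × Σ (Fin (suc k) → Fin c) λ label → ∀ u v → label u ≡ label v → Walk G S u v) →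
            Walk G S u v
  connect (c , eq , label , sound) with ℕ.+-cancelʳ-≡ k c 1 eq
  ... | ≡.refl = sound u v (unique (label u) (label v))
    where
    unique : (i j : Fin 1) → i ≡ j
    unique zero zero = ≡.refl

-- Sums and matrices over the reals.

module StretchOverReals {c ℓ₁ ℓ₂} (ℝ : RealNumbers c ℓ₁ ℓ₂) where
  open RealNumbers ℝ hiding (zero)
  open OverReals ℝ
  open SemiringSum semiring
  module R = CommutativeRing commutativeRing
  open RingProperties R.ring using (-‿distribˡ-*; -‿distribʳ-*; x[y-z]≈xy-xz; -0#≈0#; -‿involutive)
  open AbelianGroupProperties +-abelianGroup using (⁻¹-anti-homo‿-)
  module *-Props = CommutativeSemigroupProperties R.*-commutativeSemigroup
  module < = IsStrictPartialOrder <-isStrictPartialOrder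
  open SetoidReasoning R.setoid

  x-0≈x : ∀ x → x - 0# ≈ x
  x-0≈x x = trans (+-congˡ -0#≈0#) (+-identityʳ x)

  telescope : ∀ x y z → (x - y) + (y - z) ≈ x - z
  telescope x y z = begin
    (x - y) + (y - z)     ≈⟨ +-assoc x (- y) (y - z) ⟩
    x + (- y + (y - z))   ≈⟨ +-congˡ (+-assoc (- y) y (- z)) ⟨
    x + ((- y + y) - z)   ≈⟨ +-congˡ (+-congʳ (-‿inverseˡ y)) ⟩
    x + (0# - z)          ≈⟨ +-congˡ (+-identityˡ (- z)) ⟩
    x - z                 ∎

  sum-zero : ∀ {n} {f : Fin n → Carrier} → (∀ i → f i ≈ 0#) → sum f ≈ 0#
  sum-zero {n} f≈0 = trans (sum-cong-≋ f≈0) (sum-replicate-zero n)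

  1ᴹ-diagonal : ∀ {n} (i : Fin n) → 1ᴹ i i ≈ 1#
  1ᴹ-diagonal i = reflexive (≡.cong (if_then 1# else 0#) (dec-true (i ≟ i) ≡.refl))

  1ᴹ-offDiagonal : ∀ {n} {i j : Fin n} → i ≢ j → 1ᴹ i j ≈ 0#
  1ᴹ-offDiagonal {i = i} {j} i≢j = reflexive (≡.cong (if_then 1# else 0#) (dec-false (i ≟ j) i≢j))

  1ᴹ-sym : ∀ {n} (i j : Fin n) → 1ᴹ i j ≈ 1ᴹ j i
  1ᴹ-sym i j with i ≟ j
  ... | yes ≡.refl = sym (1ᴹ-diagonal i)
  ... | no  i≢j    = sym (1ᴹ-offDiagonal (i≢j ∘ ≡.sym))

  sum-1ᴹ : ∀ {n} (f : Fin n → Carrier) k → sum (λ j → f j * 1ᴹ j k) ≈ f k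
  sum-1ᴹ f zero    = trans (+-cong (*-identityʳ _) (sum-zero (λ j → zeroʳ (f (suc j))))) (+-identityʳ _)
  sum-1ᴹ f (suc k) = trans (+-cong (zeroʳ _) (sum-1ᴹ (f ∘ suc) k)) (+-identityˡ _)

  sum-elements : ∀ {m} {S : Subset m} {e} (g : Fin m → Carrier) → e ∈ S →
                 sum (λ j → g (elements S j) * 1ᴹ e (elements S j)) ≈ g e
  sum-elements {S = inside  ∷ S} g here        =
    trans (+-cong (*-identityʳ _) (sum-zero {n = ∣ S ∣} (λ j → zeroʳ (g (suc (elements S j)))))) (+-identityʳ _)
  sum-elements {S = inside  ∷ S} g (there e∈S) =
    trans (+-cong (zeroʳ _) (sum-elements (g ∘ suc) e∈S)) (+-identityˡ _)
  sum-elements {S = outside ∷ S} g (there e∈S) = sum-elements (g ∘ suc) e∈S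

  -- When `a` and `b` are the ends of an edge, this pairs `f` with the unweighted incidence column
  -- of that edge.
  sum-difference : ∀ {n} (f : Fin n → Carrier) a b → sum (λ i → f i * (1ᴹ i a - 1ᴹ i b)) ≈ f a - f b
  sum-difference f a b = begin
    sum (λ i → f i * (1ᴹ i a - 1ᴹ i b))
      ≈⟨ sum-cong-≋ (λ i → trans (distribˡ (f i) (1ᴹ i a) (- 1ᴹ i b))
          (+-congˡ (trans (sym (-‿distribʳ-* (f i) (1ᴹ i b))) (-‿distribˡ-* (f i) (1ᴹ i b))))) ⟩
    sum (λ i → f i * 1ᴹ i a + - f i * 1ᴹ i b)
      ≈⟨ ∑-distrib-+ (λ i → f i * 1ᴹ i a) (λ i → - f i * 1ᴹ i b) ⟩
    sum (λ i → f i * 1ᴹ i a) + sum (λ i → - f i * 1ᴹ i b)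
      ≈⟨ +-cong (sum-1ᴹ f a) (sum-1ᴹ (λ i → - f i) b) ⟩
    f a - f b ∎

  ≈ᴹ-setoid : ℕ → ℕ → Setoid c ℓ₁
  ≈ᴹ-setoid r s = record
    { Carrier       = Matrix r s
    ; _≈_           = _≈ᴹ_
    ; isEquivalence = record
      { refl  = λ _ _ → refl
      ; sym   = λ A≈B i j → sym (A≈B i j)
      ; trans = λ A≈B B≈C i j → trans (A≈B i j) (B≈C i j)
      }
    }
  module ≈ᴹ {r s} = Setoid (≈ᴹ-setoid r s)
  module ≈ᴹ-Reasoning {r s} = SetoidReasoning (≈ᴹ-setoid r s)

  *ᴹ-congˡ : ∀ {r s t} (A : Matrix r s) {B B′ : Matrix s t} → B ≈ᴹ B′ → A *ᴹ B ≈ᴹ A *ᴹ B′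
  *ᴹ-congˡ A B≈B′ i k = sum-cong-≋ (λ j → *-congˡ (B≈B′ j k))

  *ᴹ-congʳ : ∀ {r s t} {A A′ : Matrix r s} (B : Matrix s t) → A ≈ᴹ A′ → A *ᴹ B ≈ᴹ A′ *ᴹ B
  *ᴹ-congʳ B A≈A′ i k = sum-cong-≋ (λ j → *-congʳ (A≈A′ i j))

  *ᴹ-assoc : ∀ {r s t u} (A : Matrix r s) (B : Matrix s t) (C : Matrix t u) →
             (A *ᴹ B) *ᴹ C ≈ᴹ A *ᴹ (B *ᴹ C)
  *ᴹ-assoc A B C i l = begin
    sum (λ k → sum (λ j → A i j * B j k) * C k l)
      ≈⟨ sum-cong-≋ (λ k → *-distribʳ-sum (C k l) (λ j → A i j * B j k)) ⟩
    sum (λ k → sum (λ j → A i j * B j k * C k l))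
      ≈⟨ ∑-comm (λ k j → A i j * B j k * C k l) ⟩
    sum (λ j → sum (λ k → A i j * B j k * C k l))
      ≈⟨ sum-cong-≋ (λ j → sum-cong-≋ (λ k → *-assoc (A i j) (B j k) (C k l))) ⟩
    sum (λ j → sum (λ k → A i j * (B j k * C k l)))
      ≈⟨ sum-cong-≋ (λ j → *-distribˡ-sum (A i j) (λ k → B j k * C k l)) ⟨
    sum (λ j → A i j * sum (λ k → B j k * C k l)) ∎

  *ᴹ-identityʳ : ∀ {r s} (A : Matrix r s) → A *ᴹ 1ᴹ ≈ᴹ A
  *ᴹ-identityʳ A i k = sum-1ᴹ (A i) k

  *ᴹ-identityˡ : ∀ {r s} (A : Matrix r s) → 1ᴹ *ᴹ A ≈ᴹ A
  *ᴹ-identityˡ A i k = trans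
    (sum-cong-≋ (λ j → trans (*-comm (1ᴹ i j) (A j k)) (*-congˡ (1ᴹ-sym i j))))
    (sum-1ᴹ (λ j → A j k) i)

  *ᴹ-ᵀ : ∀ {r s t} (A : Matrix r s) (B : Matrix s t) → (A *ᴹ B) ᵀ ≈ᴹ B ᵀ *ᴹ A ᵀ
  *ᴹ-ᵀ A B i k = sum-cong-≋ (λ j → *-comm (A k j) (B j i))

  diagonal-*ᴹ : ∀ {k t} {D : Matrix k k} → (∀ i j → i ≢ j → D i j ≈ 0#) →
                ∀ (A : Matrix k t) i l → (D *ᴹ A) i l ≈ D i i * A i l
  diagonal-*ᴹ {D = D} diag A i l = trans (sum-cong-≋ entry) (sum-1ᴹ (λ j → D i i * A j l) i)
    where
    entry : ∀ j → D i j * A j l ≈ D i i * A j l * 1ᴹ j i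
    entry j with j ≟ i
    ... | yes ≡.refl = sym (*-identityʳ _)
    ... | no  j≢i    = trans (trans (*-congʳ (diag i j (j≢i ∘ ≡.sym))) (zeroˡ _)) (sym (zeroʳ _))

  -- Reciprocals and positivity.

  reciprocalˡ : ∀ {x} (0<x : 0# < x) → reciprocal 0<x * x ≈ 1#
  reciprocalˡ 0<x = proj₁ (proj₂ (positive⇒invertible 0<x))

  reciprocalʳ : ∀ {x} (0<x : 0# < x) → x * reciprocal 0<x ≈ 1#
  reciprocalʳ 0<x = proj₂ (proj₂ (positive⇒invertible 0<x))

  *-cancelˡ-pos : ∀ {x y z} → 0# < x → x * y ≈ x * z → y ≈ z
  *-cancelˡ-pos {x} {y} {z} 0<x xy≈xz = trans (sym (undo y)) (trans (*-congˡ xy≈xz) (undo z))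
    where
    undo : ∀ y → reciprocal 0<x * (x * y) ≈ y
    undo y = trans (sym (*-assoc _ _ _)) (trans (*-congʳ (reciprocalˡ 0<x)) (*-identityˡ y))

  pos-resp : ∀ {x y} → x ≈ y → 0# < x → 0# < y
  pos-resp = <.<-respʳ-≈

  -- Apartness from zero supplies the sign of `x`; for negative `x` the square is rewritten as that
  -- of `- x`.
  square-pos : ∀ {x} → x # 0# → 0# < x * x
  square-pos {x} x#0 with Equivalence.to #⇔<⊎> x#0
  ... | inj₂ 0<x = *-pos 0<x 0<x
  ... | inj₁ x<0 = pos-resp -x*-x≈x*x (*-pos 0<-x 0<-x)
    where
    0<-x : 0# < - x
    0<-x = <.<-respˡ-≈ (-‿inverseʳ x) (<.<-respʳ-≈ (+-identityˡ (- x)) (+-monoˡ-< (- x) x<0))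

    -x*-x≈x*x : - x * - x ≈ x * x
    -x*-x≈x*x = trans (sym (-‿distribˡ-* x (- x)))
      (trans (-‿cong (sym (-‿distribʳ-* x x))) (-‿involutive (x * x)))

  -- The reciprocal `y` satisfies `y ≈ x * (y * y)`, and `y * y` is positive because an invertible
  -- element is apart from zero.
  reciprocal-pos : ∀ {x} (0<x : 0# < x) → 0# < reciprocal 0<x
  reciprocal-pos {x} 0<x = pos-resp
    (trans (sym (*-assoc x y y)) (trans (*-congʳ (reciprocalʳ 0<x)) (*-identityˡ y)))
    (*-pos 0<x (square-pos y#0))
    where
    y : Carrier
    y = reciprocal 0<x

    y#0 : y # 0#
    y#0 = invertible⇒# ( x , trans (*-congˡ (x-0≈x y)) (reciprocalʳ 0<x)
                           , trans (*-congʳ (x-0≈x y)) (reciprocalˡ 0<x) )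

  -- Closure under addition is immediate here, but for 0# ≤_ = ¬ (_< 0#) it needs cotransitivity of _#_.
  ZeroOrPos : Carrier → Set _
  ZeroOrPos x = x ≈ 0# ⊎ 0# < x

  ZeroOrPos-+ : ∀ {x y} → ZeroOrPos x → ZeroOrPos y → ZeroOrPos (x + y)
  ZeroOrPos-+ (inj₁ x≈0) (inj₁ y≈0) = inj₁ (trans (+-cong x≈0 y≈0) (+-identityˡ 0#))
  ZeroOrPos-+ {x} {y} (inj₁ x≈0) (inj₂ 0<y) =
    inj₂ (pos-resp (trans (sym (+-identityˡ y)) (+-congʳ (sym x≈0))) 0<y)
  ZeroOrPos-+ {x} {y} (inj₂ 0<x) (inj₁ y≈0) =
    inj₂ (pos-resp (trans (sym (+-identityʳ x)) (+-congˡ (sym y≈0))) 0<x)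
  ZeroOrPos-+ {x} {y} (inj₂ 0<x) (inj₂ 0<y) =
    inj₂ (<.trans 0<y (<.<-respˡ-≈ (+-identityˡ y) (+-monoˡ-< y 0<x)))

  ZeroOrPos-sum : ∀ {n} (f : Fin n → Carrier) → (∀ i → ZeroOrPos (f i)) → ZeroOrPos (sum f)
  ZeroOrPos-sum {ℕ.zero} f _  = inj₁ refl
  ZeroOrPos-sum {suc n}  f f≥ = ZeroOrPos-+ (f≥ zero) (ZeroOrPos-sum (f ∘ suc) (f≥ ∘ suc))

  ZeroOrPos⇒0≤ : ∀ {x} → ZeroOrPos x → 0# ≤ x
  ZeroOrPos⇒0≤ (inj₁ x≈0) x<0 = <.irrefl x≈0 x<0
  ZeroOrPos⇒0≤ (inj₂ 0<x) x<0 = <.asym 0<x x<0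

  -- Sums over lists of edges.

  listSum : List Carrier → Carrier
  listSum = List.foldr _+_ 0#

  ZeroOrPos-listSum : ∀ {a} {A : Set a} {f : A → Carrier} → (∀ x → 0# < f x) → ∀ xs →
                      ZeroOrPos (listSum (List.map f xs))
  ZeroOrPos-listSum f> []       = inj₁ refl
  ZeroOrPos-listSum f> (x ∷ xs) = ZeroOrPos-+ (inj₂ (f> x)) (ZeroOrPos-listSum f> xs)

  count : ∀ {m} → List (Fin m) → Fin m → Carrier
  count es t = listSum (List.map (λ e → 1ᴹ e t) es)

  count-∉ : ∀ {m} {es : List (Fin m)} {t} → t ∉ᴸ es → count es t ≈ 0#
  count-∉ {es = []}     _  = refl
  count-∉ {es = e ∷ es} t∉ = trans
    (+-cong (1ᴹ-offDiagonal (t∉ ∘ here ∘ ≡.sym)) (count-∉ (t∉ ∘ there))) (+-identityˡ 0#)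

  -- Turns a sum along a path, as in `edgeStretch`, into a sum over all edges of `S`, which can be
  -- exchanged with other finite sums.
  sum-count : ∀ {m} {S : Subset m} (g : Fin m → Carrier) {es} → All (_∈ S) es →
              sum (λ j → g (elements S j) * count es (elements S j)) ≈ listSum (List.map g es)
  sum-count {S = S} g [] = sum-zero (λ j → zeroʳ (g (elements S j)))
  sum-count {S = S} g {e ∷ es} (e∈S ∷ es⊆S) = begin
    sum (λ j → g (elements S j) * (1ᴹ e (elements S j) + count es (elements S j)))
      ≈⟨ sum-cong-≋ (λ j → distribˡ (g (elements S j)) _ _) ⟩
    sum (λ j → g (elements S j) * 1ᴹ e (elements S j) + g (elements S j) * count es (elements S j))
      ≈⟨ ∑-distrib-+ (λ j → g (elements S j) * 1ᴹ e (elements S j)) _ ⟩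
    sum (λ j → g (elements S j) * 1ᴹ e (elements S j)) + sum (λ j → g (elements S j) * count es (elements S j))
      ≈⟨ +-cong (sum-elements g e∈S) (sum-count g es⊆S) ⟩
    g e + listSum (List.map g es) ∎

  -- Signed traversals of walks and differences of potentials.

  module Flow {n m} (G : Graph n m) where
    open Graph G

    sign : ∀ {e u v} → Joins e u v → Carrier
    sign (inj₁ _) = 1#
    sign (inj₂ _) = - 1#

    sign-square : ∀ {e u v} (J : Joins e u v) → sign J * sign J ≈ 1#
    sign-square (inj₁ _) = *-identityˡ 1#
    sign-square (inj₂ _) = trans (sym (-‿distribˡ-* 1# (- 1#)))
      (trans (-‿cong (*-identityˡ (- 1#))) (-‿involutive 1#))

    difference : (Fin n → Carrier) → Fin m → Carrier
    difference f e = f (src e) - f (tgt e)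

    sign-difference : ∀ (f : Fin n → Carrier) {e u v} (J : Joins e u v) →
                      sign J * difference f e ≈ f u - f v
    sign-difference f (inj₁ (≡.refl , ≡.refl)) = *-identityˡ _
    sign-difference f (inj₂ (≡.refl , ≡.refl)) = trans (sym (-‿distribˡ-* 1# _))
      (trans (-‿cong (*-identityˡ _)) (⁻¹-anti-homo‿- _ _))

    -- The coefficient of `t` in the walk regarded as a 1-chain, edges being oriented from `src` to
    -- `tgt`.
    net : ∀ {S u v} → Walk G S u v → Fin m → Carrier
    net nil            t = 0#
    net (step e _ J p) t = sign J * 1ᴹ e t + net p t

    net-∉ : ∀ {S u v} (p : Walk G S u v) {t} → t ∉ᴸ edges p → net p t ≈ 0#
    net-∉ nil            _  = refl
    net-∉ (step e i J p) t∉ = trans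
      (+-cong (trans (*-congˡ (1ᴹ-offDiagonal (t∉ ∘ here ∘ ≡.sym))) (zeroʳ _)) (net-∉ p (t∉ ∘ there)))
      (+-identityˡ 0#)

    net-first : ∀ {S e u v x} (i : e ∈ S) (J : Joins e u v) (p : Walk G S v x) → e ∉ᴸ edges p →
                net (step e i J p) e ≈ sign J
    net-first {e = e} i J p e∉ = trans (+-cong (trans (*-congˡ (1ᴹ-diagonal e)) (*-identityʳ _)) (net-∉ p e∉))
      (+-identityʳ _)

    -- No edge is repeated, so the net count is a single sign or zero, and squaring removes the
    -- sign.
    net-square : ∀ {S u v} (p : Walk G S u v) → Unique (edges p) → ∀ t →
                 net p t * net p t ≈ count (edges p) t
    net-square nil _ t = zeroˡ 0#
    net-square (step e i J p) (e∉ ∷ unique) t with e ≟ t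
    ... | yes ≡.refl = begin
      (sign J * 1# + net p e) * (sign J * 1# + net p e) ≈⟨ *-cong first first ⟩
      sign J * sign J                                   ≈⟨ sign-square J ⟩
      1#                                                ≈⟨ +-identityʳ 1# ⟨
      1# + 0#                                           ≈⟨ +-congˡ (count-∉ (All¬⇒¬Any e∉)) ⟨
      1# + count (edges p) e                            ∎
      where
      first : sign J * 1# + net p e ≈ sign J
      first = trans (+-cong (*-identityʳ _) (net-∉ p (All¬⇒¬Any e∉))) (+-identityʳ _)
    ... | no _ = begin
      (sign J * 0# + net p t) * (sign J * 0# + net p t) ≈⟨ *-cong skip skip ⟩
      net p t * net p t                                 ≈⟨ net-square p unique t ⟩
      count (edges p) t                                 ≈⟨ +-identityˡ _ ⟨
      0# + count (edges p) t                            ∎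
      where
      skip : sign J * 0# + net p t ≈ net p t
      skip = trans (+-congʳ (zeroʳ _)) (+-identityˡ _)

    -- Telescoping: each step contributes the difference of `f` across its edge, oriented along the
    -- walk, and the intermediate values cancel.
    sum-net : ∀ {S u v} (p : Walk G S u v) (f : Fin n → Carrier) →
              sum (λ j → difference f (elements S j) * net p (elements S j)) ≈ f u - f v
    sum-net {S} {u} nil f = trans (sum-zero (λ j → zeroʳ (difference f (elements S j)))) (sym (-‿inverseʳ (f u)))
    sum-net {S} {u} {x} (step {v = v} e i J p) f = begin
      sum (λ j → δ j * (sign J * 1ᴹ e (elements S j) + net p (elements S j)))
        ≈⟨ sum-cong-≋ (λ j → trans (distribˡ (δ j) _ _) (+-congʳ (sym (*-assoc (δ j) (sign J) _)))) ⟩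
      sum (λ j → δ j * sign J * 1ᴹ e (elements S j) + δ j * net p (elements S j))
        ≈⟨ ∑-distrib-+ (λ j → δ j * sign J * 1ᴹ e (elements S j)) _ ⟩
      sum (λ j → δ j * sign J * 1ᴹ e (elements S j)) + sum (λ j → δ j * net p (elements S j))
        ≈⟨ +-cong (sum-elements (λ t → difference f t * sign J) i) (sum-net p f) ⟩
      difference f e * sign J + (f v - f x)
        ≈⟨ +-congʳ (trans (*-comm _ _) (sign-difference f J)) ⟩
      (f u - f v) + (f v - f x)
        ≈⟨ telescope (f u) (f v) (f x) ⟩
      f u - f x ∎
      where
      δ : Fin ∣ S ∣ → Carrier
      δ j = difference f (elements S j)

    -- Along a walk in `S` only crossings of `t` change `f`, each by its sign.
    potential-net : ∀ {S t} (f : Fin n → Carrier) → (∀ {e} → e ∈ S → difference f e ≈ 1ᴹ e t) →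
                    ∀ {u v} (p : Walk G S u v) → f u - f v ≈ net p t
    potential-net         f δf nil = -‿inverseʳ _
    potential-net {t = t} f δf {u} {x} (step {v = v} e i J p) = begin
      f u - f x                         ≈⟨ telescope (f u) (f v) (f x) ⟨
      (f u - f v) + (f v - f x)         ≈⟨ +-cong (sym (sign-difference f J)) (potential-net f δf p) ⟩
      sign J * difference f e + net p t ≈⟨ +-congʳ (*-congˡ (δf i)) ⟩
      sign J * 1ᴹ e t + net p t         ∎

    -- Fundamental cuts of a spanning tree.

    module Cut {T : Subset m} (tree : IsSpanningTree G T) {t : Fin m} (t∈T : t ∈ T) where
      open IsSpanningTree tree

      sideOf : ∀ v → Walk G (T ∖ t) v (src t) ⊎ Walk G (T ∖ t) v (tgt t)
      sideOf v = side (proj₁ (connected v (src t)))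

      onSrcSide : ∀ {v} → Walk G (T ∖ t) v (src t) ⊎ Walk G (T ∖ t) v (tgt t) → Carrier
      onSrcSide (inj₁ _) = 1#
      onSrcSide (inj₂ _) = 0#

      cut : Fin n → Carrier
      cut v = onSrcSide (sideOf v)

      noBypass : ¬ Walk G (T ∖ t) (src t) (tgt t)
      noBypass = bridge acyclic t∈T

      -- The ends of `t` lie on opposite sides and no other tree edge joins the sides, since either
      -- failure would give a walk around `t`.
      difference-cut : ∀ {e} → e ∈ T → difference cut e ≈ 1ᴹ e t
      difference-cut {e} e∈T with e ≟ t
      difference-cut {e} e∈T | yes ≡.refl with sideOf (src t) | sideOf (tgt t)
      ... | inj₁ _ | inj₂ _ = x-0≈x 1#
      ... | inj₁ _ | inj₁ q = contradiction (reverseʷ q) noBypass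
      ... | inj₂ p | _      = contradiction p noBypass
      difference-cut {e} e∈T | no e≢t with sideOf (src e) | sideOf (tgt e)
      ... | inj₁ _ | inj₁ _ = -‿inverseʳ 1#
      ... | inj₂ _ | inj₂ _ = -‿inverseʳ 0#
      ... | inj₁ p | inj₂ q = contradiction
        (reverseʷ p ++ʷ step e (x∈p∧x≢y⇒x∈p-y e∈T e≢t) (inj₁ (≡.refl , ≡.refl)) q) noBypass
      ... | inj₂ p | inj₁ q = contradiction
        (reverseʷ q ++ʷ step e (x∈p∧x≢y⇒x∈p-y e∈T e≢t) (inj₂ (≡.refl , ≡.refl)) p) noBypass

  -- Weights and the incidence matrix.

  module Weights {n m} (G : WeightedGraph n m) where
    open WeightedGraph G
    open Flow graph

    √w : Fin m → Carrier
    √w e = √ (weight e)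

    √w-square : ∀ e → √w e * √w e ≈ weight e
    √w-square e = √-square (<.asym (weight-positive e))

    recip : Fin m → Carrier
    recip e = reciprocal (weight-positive e)

    -- Formed as root over weight, because `reciprocal` asks for a proof of positivity, which is
    -- given for weights and not for their roots.
    √w⁻¹ : Fin m → Carrier
    √w⁻¹ e = √w e * recip e

    √w*√w⁻¹ : ∀ e → √w e * √w⁻¹ e ≈ 1#
    √w*√w⁻¹ e = trans (sym (*-assoc _ _ _)) (trans (*-congʳ (√w-square e)) (reciprocalʳ (weight-positive e)))

    √w⁻¹-square : ∀ e → √w⁻¹ e * √w⁻¹ e ≈ recip e
    √w⁻¹-square e = begin
      (√w e * recip e) * (√w e * recip e) ≈⟨ *-Props.x∙yz≈y∙xz _ _ _ ⟩
      √w e * (√w⁻¹ e * recip e)           ≈⟨ *-assoc _ _ _ ⟨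
      (√w e * √w⁻¹ e) * recip e           ≈⟨ *-congʳ (√w*√w⁻¹ e) ⟩
      1# * recip e                      ≈⟨ *-identityˡ _ ⟩
      recip e                           ∎

    -- In a trivial ring the positive weight of an edge would be zero.
    1≉0 : Fin m → ¬ 1# ≈ 0#
    1≉0 e 1≈0 = <.irrefl (sym w≈0) (weight-positive e)
      where
      w≈0 : weight e ≈ 0#
      w≈0 = trans (sym (*-identityʳ _)) (trans (*-congˡ 1≈0) (zeroʳ _))

    -- Dividing by the root of the weight cancels the scaling of the incidence columns, so `sum-net`
    -- applies to the indicator `1ᴹ i`. A tree path thus expresses a column through tree columns,
    -- and a closed walk gives a linear relation.
    sum-incidence-net : ∀ {S u v} (p : Walk graph S u v) i →
      sum (λ j → incidence i (elements S j) * (√w⁻¹ (elements S j) * net p (elements S j))) ≈ 1ᴹ i u - 1ᴹ i v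
    sum-incidence-net {S} p i = trans (sum-cong-≋ (λ j → cancel (elements S j))) (sum-net p (1ᴹ i))
      where
      cancel : ∀ e → incidence i e * (√w⁻¹ e * net p e) ≈ difference (1ᴹ i) e * net p e
      cancel e = begin
        √w e * d * (√w⁻¹ e * net p e)   ≈⟨ *-assoc _ _ _ ⟨
        √w e * d * √w⁻¹ e * net p e     ≈⟨ *-congʳ (*-Props.xy∙z≈xz∙y _ _ _) ⟩
        √w e * √w⁻¹ e * d * net p e     ≈⟨ *-congʳ (*-congʳ (√w*√w⁻¹ e)) ⟩
        1# * d * net p e              ≈⟨ *-congʳ (*-identityˡ d) ⟩
        d * net p e                   ∎
        where
        d : Carrier
        d = difference (1ᴹ i) e

    -- Transfer through the singular value decomposition.

    module SVD {k} {U : Matrix n k} {D : Matrix k k} {V : Matrix m k}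
               (svd : IsThinSVD incidence U D V) where
      open IsThinSVD svd

      W : Matrix n k
      W = U *ᴹ D

      -- Multiplication by `U ᵀ` removes `U`, and then each row is divided by a positive diagonal
      -- entry of `D`.
      W-cancel : ∀ {t} {A B : Matrix k t} → W *ᴹ A ≈ᴹ W *ᴹ B → A ≈ᴹ B
      W-cancel {t} {A} {B} WA≈WB i l = *-cancelˡ-pos (D-positive i) (begin
        D i i * A i l  ≈⟨ diagonal-*ᴹ D-diagonal A i l ⟨
        (D *ᴹ A) i l   ≈⟨ DA≈DB i l ⟩
        (D *ᴹ B) i l   ≈⟨ diagonal-*ᴹ D-diagonal B i l ⟩
        D i i * B i l  ∎)
        where
        UᵀW : ∀ (A : Matrix k t) → U ᵀ *ᴹ (W *ᴹ A) ≈ᴹ D *ᴹ A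
        UᵀW A = ≈ᴹ-Reasoning.begin
          U ᵀ *ᴹ (W *ᴹ A)         ≈ᴹ-Reasoning.≈⟨ *ᴹ-congˡ (U ᵀ) (*ᴹ-assoc U D A) ⟩
          U ᵀ *ᴹ (U *ᴹ (D *ᴹ A))  ≈ᴹ-Reasoning.≈⟨ *ᴹ-assoc (U ᵀ) U (D *ᴹ A) ⟨
          U ᵀ *ᴹ U *ᴹ (D *ᴹ A)    ≈ᴹ-Reasoning.≈⟨ *ᴹ-congʳ (D *ᴹ A) U-orthonormal ⟩
          1ᴹ *ᴹ (D *ᴹ A)          ≈ᴹ-Reasoning.≈⟨ *ᴹ-identityˡ (D *ᴹ A) ⟩
          D *ᴹ A                  ≈ᴹ-Reasoning.∎

        DA≈DB : D *ᴹ A ≈ᴹ D *ᴹ B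
        DA≈DB = ≈ᴹ.trans (≈ᴹ.sym (UᵀW A)) (≈ᴹ.trans (*ᴹ-congˡ (U ᵀ) WA≈WB) (UᵀW B))

      VVᵀ-cancel : ∀ {r} (Z : Matrix r k) → Z *ᴹ V ᵀ *ᴹ V ≈ᴹ Z
      VVᵀ-cancel Z = ≈ᴹ.trans (*ᴹ-assoc Z (V ᵀ) V)
        (≈ᴹ.trans (*ᴹ-congˡ Z V-orthonormal) (*ᴹ-identityʳ Z))

      -- With `W-cancel`, this lets identities between columns of `V ᵀ` be checked on columns of the
      -- incidence matrix.
      W*columns : ∀ S {t} (A : Matrix ∣ S ∣ t) →
                  W *ᴹ (columns (V ᵀ) S *ᴹ A) ≈ᴹ columns incidence S *ᴹ A
      W*columns S A = ≈ᴹ.trans (≈ᴹ.sym (*ᴹ-assoc W (columns (V ᵀ) S) A))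
        (*ᴹ-congʳ A (λ i j → sym (factorization i (elements S j))))

      -- The inverse of the tree columns and the stretch.

      module Tree {T : Subset m} (tree : IsSpanningTree graph T) where
        open IsSpanningTree tree

        cut : Fin ∣ T ∣ → Fin n → Carrier
        cut j = Cut.cut tree (elements-∈ T j)

        difference-cut : ∀ j {e} → e ∈ T → difference (cut j) e ≈ 1ᴹ e (elements T j)
        difference-cut j = Cut.difference-cut tree (elements-∈ T j)

        path : ∀ e → Walk graph T (src e) (tgt e)
        path e = proj₁ (connected (src e) (tgt e))

        Q : Matrix ∣ T ∣ n
        Q j v = √w⁻¹ (elements T j) * cut j v

        Z : Matrix ∣ T ∣ k
        Z = Q *ᴹ W

        -- By `factorization` this is `Q` times the incidence matrix; written through `Z`, it allows
        -- `VVᵀ-cancel`.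
        P : Matrix ∣ T ∣ m
        P = Z *ᴹ V ᵀ

        P≈cut : ∀ j e → P j e ≈ √w e * (√w⁻¹ (elements T j) * difference (cut j) e)
        P≈cut j e = begin
          (Z *ᴹ V ᵀ) j e
            ≈⟨ *ᴹ-assoc Q W (V ᵀ) j e ⟩
          (Q *ᴹ (W *ᴹ V ᵀ)) j e
            ≈⟨ *ᴹ-congˡ Q factorization j e ⟨
          sum (λ i → Q j i * (√w e * (1ᴹ i (src e) - 1ᴹ i (tgt e))))
            ≈⟨ sum-cong-≋ (λ i → *-Props.x∙yz≈y∙xz (Q j i) (√w e) _) ⟩
          sum (λ i → √w e * (Q j i * (1ᴹ i (src e) - 1ᴹ i (tgt e))))
            ≈⟨ *-distribˡ-sum (√w e) (λ i → Q j i * (1ᴹ i (src e) - 1ᴹ i (tgt e))) ⟨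
          √w e * sum (λ i → Q j i * (1ᴹ i (src e) - 1ᴹ i (tgt e)))
            ≈⟨ *-congˡ (sum-difference (Q j) (src e) (tgt e)) ⟩
          √w e * (Q j (src e) - Q j (tgt e))
            ≈⟨ *-congˡ (x[y-z]≈xy-xz _ _ _) ⟨
          √w e * (√w⁻¹ (elements T j) * difference (cut j) e) ∎

        -- The tree path joins the ends of `e` even when `e` lies outside `T`, so `potential-net`
        -- evaluates the cut difference on every edge.
        P≈net : ∀ j e → P j e ≈ √w e * (√w⁻¹ (elements T j) * net (path e) (elements T j))
        P≈net j e = trans (P≈cut j e)
          (*-congˡ (*-congˡ (potential-net (cut j) (difference-cut j) (path e))))

        Z*Y≈1 : Z *ᴹ columns (V ᵀ) T ≈ᴹ 1ᴹ
        Z*Y≈1 j l = begin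
          -- Restricting `V ᵀ` to the columns in `T` before or after multiplying by `Z` is
          -- definitionally the same.
          P j (elements T l)
            ≈⟨ P≈cut j (elements T l) ⟩
          √w (elements T l) * (√w⁻¹ (elements T j) * difference (cut j) (elements T l))
            ≈⟨ *-congˡ (*-congˡ (difference-cut j (elements-∈ T l))) ⟩
          √w (elements T l) * (√w⁻¹ (elements T j) * 1ᴹ (elements T l) (elements T j))
            ≈⟨ *-assoc _ _ _ ⟨
          √w (elements T l) * √w⁻¹ (elements T j) * 1ᴹ (elements T l) (elements T j)
            ≈⟨ kronecker ⟩
          1ᴹ j l ∎
          where
          kronecker : √w (elements T l) * √w⁻¹ (elements T j) * 1ᴹ (elements T l) (elements T j) ≈ 1ᴹ j l
          kronecker with j ≟ l
          ... | yes ≡.refl = trans (*-cong (√w*√w⁻¹ (elements T j)) (1ᴹ-diagonal (elements T j))) (*-identityˡ 1#)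
          ... | no  j≢l    = trans (*-congˡ (1ᴹ-offDiagonal (j≢l ∘ ≡.sym ∘ elements-injective T))) (zeroʳ _)

        -- The coefficients in column `e` of `P` come from the tree path of `e`, along which the
        -- tree columns add up to the column of `e`.
        incidence*P : columns incidence T *ᴹ P ≈ᴹ incidence
        incidence*P i e = begin
          sum (λ j → incidence i (elements T j) * P j e)
            ≈⟨ sum-cong-≋ (λ j → trans (*-congˡ (P≈net j e)) (*-Props.x∙yz≈y∙xz _ (√w e) _)) ⟩
          sum (λ j → √w e * (incidence i (elements T j) * (√w⁻¹ (elements T j) * net (path e) (elements T j))))
            ≈⟨ *-distribˡ-sum (√w e) (λ j → incidence i (elements T j) * (√w⁻¹ (elements T j) * net (path e) (elements T j))) ⟨
          √w e * sum (λ j → incidence i (elements T j) * (√w⁻¹ (elements T j) * net (path e) (elements T j)))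
            ≈⟨ *-congˡ (sum-incidence-net (path e) i) ⟩
          incidence i e ∎

        -- The types do not identify `∣ T ∣` with `k`, so this side of the inverse gets its own
        -- proof: after multiplication by `W` it says that the tree columns reproduce the incidence
        -- matrix.
        Y*Z≈1 : columns (V ᵀ) T *ᴹ Z ≈ᴹ 1ᴹ
        Y*Z≈1 = W-cancel (≈ᴹ-Reasoning.begin
          W *ᴹ (columns (V ᵀ) T *ᴹ Z)        ≈ᴹ-Reasoning.≈⟨ W*columns T Z ⟩
          columns incidence T *ᴹ Z           ≈ᴹ-Reasoning.≈⟨ *ᴹ-congˡ (columns incidence T) (VVᵀ-cancel Z) ⟨
          columns incidence T *ᴹ (P *ᴹ V)    ≈ᴹ-Reasoning.≈⟨ *ᴹ-assoc (columns incidence T) P V ⟨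
          columns incidence T *ᴹ P *ᴹ V      ≈ᴹ-Reasoning.≈⟨ *ᴹ-congʳ V incidence*P ⟩
          incidence *ᴹ V                     ≈ᴹ-Reasoning.≈⟨ *ᴹ-congʳ V factorization ⟩
          W *ᴹ V ᵀ *ᴹ V                      ≈ᴹ-Reasoning.≈⟨ VVᵀ-cancel W ⟩
          W                                  ≈ᴹ-Reasoning.≈⟨ *ᴹ-identityʳ W ⟨
          W *ᴹ 1ᴹ                            ≈ᴹ-Reasoning.∎)

        -- Multiplication by `V ᵀ` preserves inner products of rows; on the diagonal these are the
        -- squared row norms.
        PPᵀ≈ZZᵀ : P *ᴹ P ᵀ ≈ᴹ Z *ᴹ Z ᵀ
        PPᵀ≈ZZᵀ = ≈ᴹ-Reasoning.begin
          P *ᴹ P ᵀ            ≈ᴹ-Reasoning.≈⟨ *ᴹ-congˡ P (*ᴹ-ᵀ Z (V ᵀ)) ⟩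
          P *ᴹ (V *ᴹ Z ᵀ)     ≈ᴹ-Reasoning.≈⟨ *ᴹ-assoc P V (Z ᵀ) ⟨
          P *ᴹ V *ᴹ Z ᵀ       ≈ᴹ-Reasoning.≈⟨ *ᴹ-congʳ (Z ᵀ) (VVᵀ-cancel Z) ⟩
          Z *ᴹ Z ᵀ            ≈ᴹ-Reasoning.∎

        P-square : ∀ j e → P j e * P j e ≈ weight e * recip (elements T j) * count (treePath e) (elements T j)
        P-square j e = begin
          P j e * P j e
            ≈⟨ *-cong (P≈net j e) (P≈net j e) ⟩
          (√w e * (√w⁻¹ t * x)) * (√w e * (√w⁻¹ t * x))
            ≈⟨ *-interchange (√w e) (√w⁻¹ t * x) (√w e) (√w⁻¹ t * x) ⟩
          (√w e * √w e) * ((√w⁻¹ t * x) * (√w⁻¹ t * x))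
            ≈⟨ *-cong (√w-square e) (*-interchange (√w⁻¹ t) x (√w⁻¹ t) x) ⟩
          weight e * ((√w⁻¹ t * √w⁻¹ t) * (x * x))
            ≈⟨ *-congˡ (*-cong (√w⁻¹-square t) (net-square (path e) unique t)) ⟩
          weight e * (recip t * count (treePath e) t)
            ≈⟨ *-assoc _ _ _ ⟨
          weight e * recip t * count (treePath e) t ∎
          where
          open *-Props using () renaming (interchange to *-interchange)

          t : Fin m
          t = elements T j

          x : Carrier
          x = net (path e) t

          unique : Unique (treePath e)
          unique = path⇒uniqueEdges (path e) (proj₂ (connected (src e) (tgt e)))

        -- The squared entries of `P` are counted twice: column by column they give edge stretches,
        -- row by row the squared row norms of `Z`.
        sumOfSquares : stretch tree ≈ sum (λ j → sum (λ i → Z j i * Z j i))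
        sumOfSquares = begin
          sum (edgeStretch tree)
            ≈⟨ sum-cong-≋ (λ e → sum-count (λ t → weight e * recip t) (edges-⊆ (path e))) ⟨
          sum (λ e → sum (λ j → weight e * recip (elements T j) * count (treePath e) (elements T j)))
            ≈⟨ sum-cong-≋ (λ e → sum-cong-≋ (λ j → P-square j e)) ⟨
          sum (λ e → sum (λ j → P j e * P j e))
            ≈⟨ ∑-comm (λ e j → P j e * P j e) ⟩
          sum (λ j → sum (λ e → P j e * P j e))
            ≈⟨ sum-cong-≋ (λ j → PPᵀ≈ZZᵀ j j) ⟩
          sum (λ j → sum (λ i → Z j i * Z j i)) ∎

        -- Squaring the norm undoes its root only for a nonnegative argument, as `√-square` demands.
        stretch-ZeroOrPos : ZeroOrPos (stretch tree)
        stretch-ZeroOrPos = ZeroOrPos-sum (edgeStretch tree) λ e → ZeroOrPos-listSum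
          (λ t → *-pos (weight-positive e) (reciprocal-pos (weight-positive t))) (treePath e)

        stretch≈∥Z∥² : stretch tree ≈ ∥ Z ∥F * ∥ Z ∥F
        stretch≈∥Z∥² = begin
          stretch tree                        ≈⟨ √-square (ZeroOrPos⇒0≤ stretch-ZeroOrPos) ⟨
          √ stretch tree * √ stretch tree     ≈⟨ *-cong (√-cong sumOfSquares) (√-cong sumOfSquares) ⟩
          ∥ Z ∥F * ∥ Z ∥F                     ∎

      -- The rescaled signed traversals of a cycle are a linear relation, so independence makes them
      -- vanish. But the first edge is crossed once, so its net count is a sign, whose square is 1.
      independent⇒acyclic : ∀ {S} →
        LinearlyIndependent (λ j → (columns (V ᵀ) S ᵀ) j) → IsAcyclic graph S
      independent⇒acyclic _ nil (nonempty , _) = nonempty ≡.refl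
      independent⇒acyclic {S} independent {u} p@(step e e∈S J q) (_ , e∉ ∷ _ , _) =
        1≉0 e (trans (sym (sign-square J)) (trans (*-congʳ sign≈0) (zeroˡ _)))
        where
        -- The coefficient vector is a one-column matrix so that `W-cancel` and `W*columns` apply.
        b : Matrix ∣ S ∣ 1
        b j _ = √w⁻¹ (elements S j) * net p (elements S j)

        0ᴹ : Matrix k 1
        0ᴹ _ _ = 0#

        Y*b≈0 : columns (V ᵀ) S *ᴹ b ≈ᴹ 0ᴹ
        Y*b≈0 = W-cancel λ i o → begin
          (W *ᴹ (columns (V ᵀ) S *ᴹ b)) i o  ≈⟨ W*columns S b i o ⟩
          (columns incidence S *ᴹ b) i o     ≈⟨ sum-incidence-net p i ⟩
          1ᴹ i u - 1ᴹ i u                    ≈⟨ -‿inverseʳ _ ⟩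
          0#                                 ≈⟨ sum-zero (λ l → zeroʳ (W i l)) ⟨
          (W *ᴹ 0ᴹ) i o                      ∎

        b≈0 : ∀ j → b j zero ≈ 0#
        b≈0 = independent (λ j → b j zero)
          (λ i → trans (sum-cong-≋ (λ j → *-comm (b j zero) (V (elements S j) i))) (Y*b≈0 i zero))

        net≈0 : ∀ {t} → t ∈ S → net p t ≈ 0#
        net≈0 {t} t∈S with ∈⇒elements t∈S
        ... | j , ≡.refl = begin
          net p t                  ≈⟨ *-identityˡ _ ⟨
          1# * net p t             ≈⟨ *-congʳ (√w*√w⁻¹ t) ⟨
          √w t * √w⁻¹ t * net p t    ≈⟨ *-assoc _ _ _ ⟩
          √w t * (√w⁻¹ t * net p t)  ≈⟨ *-congˡ (b≈0 j) ⟩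
          √w t * 0#                 ≈⟨ zeroʳ _ ⟩
          0#                       ∎

        sign≈0 : sign J ≈ 0#
        sign≈0 = trans (sym (net-first e∈S J q (All¬⇒¬Any e∉))) (net≈0 e∈S)

  -- The rank definition selects columns by an injection `f`; between sets of equal size it is a
  -- permutation, which only reorders the linear combination.
  independent-permute : ∀ {r s t} (v : Fin s → Fin r → Carrier) (f : Fin t → Fin s) → t ≡ s →
    Injective _≡_ _≡_ f → LinearlyIndependent (v ∘ f) → LinearlyIndependent v
  independent-permute v f t≡s f-injective independent a Σav≈0 j =
    trans (reflexive (≡.cong a (≡.sym (inverseʳ π))))
      (independent (a ∘ f)
        (λ i → trans (sym (sum-permute (λ j → a j * v j i) π)) (Σav≈0 i)) (π ⟨$⟩ˡ j))
    where
    π = injective⇒permutation f t≡s f-injective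

theorem5p1 : ∀ {c ℓ₁ ℓ₂} (ℝ : RealNumbers c ℓ₁ ℓ₂) →
    let open RealNumbers ℝ
        open OverReals ℝ
        open WeightedGraph
    in
    -- The number of vertices is n = suc k, so that k = n - 1.
    (k m : ℕ) (G : WeightedGraph (suc k) m) → IsConnected (graph G) ⊤ →
    (U : Matrix (suc k) k) (D : Matrix k k) (V : Matrix m k) →
    IsThinSVD (incidence G) U D V →
    let Y = V ᵀ in
    ((T : Subset m) (tree : IsSpanningTree (graph G) T) →
       ∃[ Z ] (IsInverse (columns Y T) Z × stretch G tree ≈ ∥ Z ∥F * ∥ Z ∥F))
    ×
    ((S : Subset m) → ∣ S ∣ ≡ k → FullRank (columns Y S) →
       IsSpanningTree (graph G) S)
theorem5p1 ℝ k m G _ U D V svd = part₁ , part₂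
  where
  open OverReals ℝ
  open WeightedGraph G using (graph)
  open StretchOverReals ℝ
  open Weights G
  open SVD svd

  part₁ : (T : Subset m) (tree : IsSpanningTree graph T) →
          ∃[ Z ] (IsInverse (columns (V ᵀ) T) Z × _)
  part₁ T tree = Tree.Z tree , (Tree.Y*Z≈1 tree , Tree.Z*Y≈1 tree) , Tree.stretch≈∥Z∥² tree

  part₂ : (S : Subset m) → ∣ S ∣ ≡ k → FullRank (columns (V ᵀ) S) → IsSpanningTree graph S
  part₂ S ∣S∣≡k ((f , f-injective , independent) , _) = record
    { connected = acyclic⇒connected S ∣S∣≡k acyclic
    ; acyclic   = acyclic
    }
    where
    -- `FullRank` provides `k ⊓ ∣ S ∣` independent columns, which here are all of them.
    k⊓∣S∣≡∣S∣ : k ℕ.⊓ ∣ S ∣ ≡ ∣ S ∣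
    k⊓∣S∣≡∣S∣ = ℕ.m≥n⇒m⊓n≡n (ℕ.≤-reflexive ∣S∣≡k)

    acyclic : IsAcyclic graph S
    acyclic = independent⇒acyclic (independent-permute _ f k⊓∣S∣≡∣S∣ f-injective independent)
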